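{- Let $q$ be a prime power with $q=2m+1$ and $q\equiv 3 \pmod 4$. Suppose $a,b\in D_{1}^{2}$ satisfy $ab=1$, and let $M=\begin{pmatrix}1 & a\\ b & 1\end{pmatrix}$. Then $(C_{1}^{(q,2)})^{M}$ is the adjacency matrix of a directed strongly regular graph with parameters $(2(2m+1),\,2m,\,m,\,m-1,\,m)$.
   Context: Let $\alpha$ be a primitive element of $\mathbb{F}_q$; for $e\mid q-1$ the cyclotomic classes of order $e$ are $D_{0}^{e}=\langle\alpha^{e}\rangle$ and $D_{i}^{e}=\alpha^{i}D_{0}^{e}$, $i=1,\dots,e-1$ (so $D_1^2$ is the set of quadratic nonresidues). For $\sigma\in\mathbb{F}_q$, $C_{\sigma}^{(q,e)}$ is the $0$-$1$ matrix with rows and columns indexed by $\mathbb{F}_q$ whose $(x,y)$ entry is $1$ iff $x\in\sigma y+D_{0}^{e}$; for an $e\times e$ matrix $M$ over $\mathbb{F}_q$, $(C_{1}^{(q,e)})^{M}$ is the block matrix whose $(i,j)$ block is $C_{M_{ij}}^{(q,e)}$. A directed graph with adjacency matrix $A$ on $v$ vertices is directed strongly regular with parameters $(v,k,t,\lambda,\mu)$ if $A^{2}=tI+\lambda A+\mu(J-I-A)$ and $AJ=JA=kJ$. -}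

module Defs where

open import Level using (0ℓ)
open import Data.Nat as ℕ using (ℕ; zero; suc; _∸_)
open import Data.Nat.Primality using (Prime)
open import Data.Integer as ℤ using (ℤ)
open import Data.Fin using (Fin; zero; suc)
open import Data.Bool using (Bool; true; false; if_then_else_)
open import Data.List using (List; []; _∷_; length; foldr; upTo; allFin; cartesianProduct)
open import Data.List.Relation.Unary.Any using (Any; any?)
open import Data.List.Relation.Unary.Unique.Propositional using (Unique)
open import Data.List.Membership.Propositional using (_∈_)
open import Data.Sum using (_⊎_)
open import Data.Product using (Σ; _×_; _,_; ∃; ∃-syntax)
open import Relation.Nullary using (¬_; Dec; does)
open import Relation.Binary.PropositionalEquality using (_≡_; _≢_)
open import Relation.Binary.Definitions using (DecidableEquality)
open import Algebra.Structures using (IsCommutativeRing)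

record FiniteField : Set₁ where
  infixl 7 _*_
  infixl 6 _+_
  field
    Carrier  : Set
    _≟_      : DecidableEquality Carrier
    _+_ _*_  : Carrier → Carrier → Carrier
    -_       : Carrier → Carrier
    0# 1#    : Carrier
    isCommutativeRing : IsCommutativeRing _≡_ _+_ _*_ -_ 0# 1#
    0≢1      : 0# ≢ 1#
    inverse  : ∀ x → x ≢ 0# → ∃[ y ] x * y ≡ 1#
    elements : List Carrier
    elements-unique   : Unique elements
    elements-complete : ∀ x → x ∈ elements

  order : ℕ
  order = length elements

  _^_ : Carrier → ℕ → Carrier
  x ^ zero  = 1#
  x ^ suc n = x * (x ^ n)

  IsPrimitive : Carrier → Set
  IsPrimitive α = α ≢ 0# × (∀ x → x ≢ 0# → ∃[ k ] α ^ k ≡ x)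

  -- x ∈ D_i^e = α^i ⟨α^e⟩ (w.r.t. the element α).  The cyclic group ⟨α^e⟩ is
  -- listed as (α^e)^k for 0 ≤ k < q-1 (its order divides q-1).
  InClass : (α : Carrier) (e i : ℕ) → Carrier → Set
  InClass α e i x = Any (λ k → x ≡ (α ^ i) * ((α ^ e) ^ k)) (upTo (order ∸ 1))

  InShiftedD0 : (α : Carrier) (e : ℕ) (σ x y : Carrier) → Set
  InShiftedD0 α e σ x y = Any (λ k → x ≡ σ * y + (α ^ e) ^ k) (upTo (order ∸ 1))

  inShiftedD0? : ∀ α e σ x y → Dec (InShiftedD0 α e σ x y)
  inShiftedD0? α e σ x y = any? (λ k → x ≟ (σ * y + (α ^ e) ^ k)) (upTo (order ∸ 1))

  C : (α : Carrier) (e : ℕ) (σ : Carrier) → Carrier → Carrier → ℤ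
  C α e σ x y = if does (inShiftedD0? α e σ x y) then ℤ.+ 1 else ℤ.+ 0

  -- (C_1^{(q,e)})^M for an e×e matrix M: rows/columns indexed by Fin e × F_q,
  -- the (i,j) block being C_{M i j}^{(q,e)}.
  blockC : (α : Carrier) (e : ℕ) (M : Fin e → Fin e → Carrier)
         → Fin e × Carrier → Fin e × Carrier → ℤ
  blockC α e M (i , x) (j , y) = C α e (M i j) x y

  blockVertices : (e : ℕ) → List (Fin e × Carrier)
  blockVertices e = cartesianProduct (allFin e) elements

sumOver : {V : Set} → List V → (V → ℤ) → ℤ
sumOver vs f = foldr (λ v acc → f v ℤ.+ acc) (ℤ.+ 0) vs

δ : {V : Set} → DecidableEquality V → V → V → ℤ
δ _≟V_ u w = if does (u ≟V w) then ℤ.+ 1 else ℤ.+ 0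

record IsDSRG {V : Set} (_≟V_ : DecidableEquality V) (vs : List V)
              (A : V → V → ℤ) (v k t λ' μ : ℕ) : Set where
  field
    vertices-unique   : Unique vs
    vertices-complete : ∀ u → u ∈ vs
    num-vertices      : length vs ≡ v
    zero-one          : ∀ u w → A u w ≡ ℤ.+ 0 ⊎ A u w ≡ ℤ.+ 1
    square-eq : ∀ u w →
      sumOver vs (λ x → A u x ℤ.* A x w)
        ≡ ℤ.+ t ℤ.* δ _≟V_ u w
          ℤ.+ ℤ.+ λ' ℤ.* A u w
          ℤ.+ ℤ.+ μ ℤ.* (ℤ.+ 1 ℤ.- δ _≟V_ u w ℤ.- A u w)
    row-sums : ∀ u → sumOver vs (λ w → A u w) ≡ ℤ.+ k
    col-sums : ∀ w → sumOver vs (λ u → A u w) ≡ ℤ.+ k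

IsPrimePower : ℕ → Set
IsPrimePower q = ∃[ p ] ∃[ n ] (Prime p × n ℕ.≥ 1 × q ≡ p ℕ.^ n)

mat2 : {A : Set} → A → A → A → A → Fin 2 → Fin 2 → A
mat2 r00 r01 r10 r11 zero    zero    = r00
mat2 r00 r01 r10 r11 zero    (suc _) = r01
mat2 r00 r01 r10 r11 (suc _) zero    = r10
mat2 r00 r01 r10 r11 (suc _) (suc _) = r11

open import Data.Product.Properties using (≡-dec)
import Data.Fin.Properties as FinP

vertexDec : (F : FiniteField) (e : ℕ) → DecidableEquality (Fin e × FiniteField.Carrier F)
vertexDec F e = ≡-dec FinP._≟_ (FiniteField._≟_ F)

module Submission where

-- Write χ for the indicator of D_0^2 = ⟨α²⟩.  The (x,y) entry of the block C_σ
-- is χ(x - σy), so row and column sums of each block equal |D_0^2| = m.  Since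
-- α has order exactly q - 1 = 2m, χ(α^i) records the parity of i; as m is odd,
-- -1 = α^m is a non-square, so D_0^2 is a skew set (F* = D ⊎ -D) and a
-- non-square s acts on χ like negation: χ(st) = χ(-t).  For a skew set,
--   Σ_z χ(x - z) (χ(z - c) + χ(c - z)) = |D| - χ(x - c),
-- and each entry of A² is such a sum after rescaling the summation variable
-- by a or b in one of its two block products; this gives A² = mJ - A.

open import Defs
open import Level using (0ℓ)
import Data.Nat as ℕ
open ℕ using (ℕ; zero; suc; _∸_; NonZero; parity)
import Data.Nat.Properties as ℕP
open import Data.Nat.DivMod using (_/_; m%n<n; m≡m%n+[m/n]*n; [m+kn]%n≡m%n)
import Data.Nat.Tactic.RingSolver as ℕSolver
open import Data.Parity.Base as ℙ using (0ℙ; 1ℙ; _⁻¹)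
import Data.Parity.Properties as ℙP
open import Data.Integer as ℤ using (ℤ)
import Data.Integer.Properties as ℤP
open import Data.Integer.Tactic.RingSolver using (solve-∀)
open import Data.Fin as Fin using (Fin; toℕ)
import Data.Fin.Properties as FinP
open import Data.Bool using (if_then_else_)
open import Data.List using (List; []; _∷_; _++_; map; length; lookup; upTo)
open import Data.List.Relation.Unary.Any as Any using (Any; here; there)
open import Data.List.Relation.Unary.Any.Properties using (lookup-index)
import Data.List.Relation.Unary.All as All
open import Data.List.Relation.Unary.AllPairs using (_∷_)
open import Data.List.Relation.Unary.Unique.Propositional using (Unique)
import Data.List.Properties as LP
open import Data.List.Membership.Propositional using (_∈_; _∉_)
open import Data.List.Membership.Propositional.Properties using (∈-lookup; ∈-upTo⁺; ∈-allFin; ∈-cartesianProduct⁺)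
open import Data.List.Relation.Unary.Unique.Propositional.Properties using (allFin⁺; cartesianProduct⁺)
open import Data.Product using (_×_; _,_; ∃₂; ∃-syntax; proj₁; proj₂)
open import Data.Sum using (_⊎_; inj₁; inj₂; [_,_])
open import Data.Empty using (⊥)
open import Function using (_∘_; id)
open import Algebra.Bundles using (CommutativeRing)
open import Algebra.Structures using (IsCommutativeRing)
open import Relation.Nullary using (Dec; yes; no; does; contradiction)
open import Relation.Binary.Definitions using (DecidableEquality; tri<; tri≈; tri>)
open import Relation.Binary.PropositionalEquality using (_≡_; _≢_; refl; sym; trans; cong; cong₂; subst; module ≡-Reasoning)

𝟙 : {P : Set} → Dec P → ℤ
𝟙 d = if does d then ℤ.+ 1 else ℤ.+ 0

𝟙-cong : ∀ {P Q : Set} (p : Dec P) (q : Dec Q) → (P → Q) → (Q → P) → 𝟙 p ≡ 𝟙 q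
𝟙-cong (yes _) (yes _) _   _   = refl
𝟙-cong (no _)  (no _)  _   _   = refl
𝟙-cong (yes p) (no ¬q) p⇒q _   = contradiction (p⇒q p) ¬q
𝟙-cong (no ¬p) (yes q) _   q⇒p = contradiction (q⇒p q) ¬p

𝟙-zero-one : ∀ {P : Set} (p : Dec P) → 𝟙 p ≡ ℤ.+ 0 ⊎ 𝟙 p ≡ ℤ.+ 1
𝟙-zero-one (yes _) = inj₂ refl
𝟙-zero-one (no _)  = inj₁ refl

module _ {V : Set} where

  sum-cong : ∀ (l : List V) {f g : V → ℤ} → (∀ x → f x ≡ g x) → sumOver l f ≡ sumOver l g
  sum-cong []      f≗g = refl
  sum-cong (x ∷ l) f≗g = cong₂ ℤ._+_ (f≗g x) (sum-cong l f≗g)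

  sum-+ : ∀ (l : List V) (f g : V → ℤ) →
          sumOver l (λ x → f x ℤ.+ g x) ≡ sumOver l f ℤ.+ sumOver l g
  sum-+ []      f g = refl
  sum-+ (x ∷ l) f g = trans (cong (λ v → (f x ℤ.+ g x) ℤ.+ v) (sum-+ l f g))
                            (interchange (f x) (g x) (sumOver l f) (sumOver l g))
    where interchange : ∀ a b c d → a ℤ.+ b ℤ.+ (c ℤ.+ d) ≡ a ℤ.+ c ℤ.+ (b ℤ.+ d)
          interchange = solve-∀

  sum-neg : ∀ (l : List V) (f : V → ℤ) → sumOver l (λ x → ℤ.- f x) ≡ ℤ.- sumOver l f
  sum-neg []      f = refl
  sum-neg (x ∷ l) f = trans (cong (λ v → ℤ.- f x ℤ.+ v) (sum-neg l f)) (sym (ℤP.neg-distrib-+ (f x) _))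

  sum-const-zero : ∀ (l : List V) → sumOver l (λ _ → ℤ.+ 0) ≡ ℤ.+ 0
  sum-const-zero []      = refl
  sum-const-zero (_ ∷ l) = trans (ℤP.+-identityˡ _) (sum-const-zero l)

  sum-const-one : ∀ (l : List V) → sumOver l (λ _ → ℤ.+ 1) ≡ ℤ.+ length l
  sum-const-one []      = refl
  sum-const-one (_ ∷ l) = cong (λ v → ℤ.+ 1 ℤ.+ v) (sum-const-one l)

  sum-++ : ∀ (l l′ : List V) (f : V → ℤ) → sumOver (l ++ l′) f ≡ sumOver l f ℤ.+ sumOver l′ f
  sum-++ []      l′ f = sym (ℤP.+-identityˡ _)
  sum-++ (x ∷ l) l′ f = trans (cong (λ v → f x ℤ.+ v) (sum-++ l l′ f)) (sym (ℤP.+-assoc (f x) _ _))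

  sum-swap : ∀ (l l′ : List V) (F : V → V → ℤ) →
    sumOver l (λ x → sumOver l′ (F x)) ≡ sumOver l′ (λ y → sumOver l (λ x → F x y))
  sum-swap []      l′ F = sym (sum-const-zero l′)
  sum-swap (x ∷ l) l′ F = trans (cong (λ v → sumOver l′ (F x) ℤ.+ v) (sum-swap l l′ F))
                                (sym (sum-+ l′ (F x) _))

sum-map : ∀ {A B : Set} (g : A → B) (l : List A) (f : B → ℤ) →
          sumOver (map g l) f ≡ sumOver l (f ∘ g)
sum-map g []      f = refl
sum-map g (x ∷ l) f = cong (λ v → f (g x) ℤ.+ v) (sum-map g l f)

module Enumeration {V : Set} (_≟_ : DecidableEquality V)
                   (vs : List V) (vs-unique : Unique vs) (vs-complete : ∀ v → v ∈ vs) where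

  sum-δ-absent : ∀ (l : List V) {c} → c ∉ l → ∀ (f : V → ℤ) → sumOver l (λ x → δ _≟_ c x ℤ.* f x) ≡ ℤ.+ 0
  sum-δ-absent []      c∉l f = refl
  sum-δ-absent (x ∷ l) {c} c∉l f with c ≟ x
  ... | yes refl = contradiction (here refl) c∉l
  ... | no _     = trans (cong (λ v → v ℤ.+ sumOver l (λ y → δ _≟_ c y ℤ.* f y)) (ℤP.*-zeroˡ (f x)))
                         (trans (ℤP.+-identityˡ _) (sum-δ-absent l (c∉l ∘ there) f))

  sum-δ-in : ∀ (l : List V) → Unique l → ∀ {c} → c ∈ l → ∀ (f : V → ℤ) →
             sumOver l (λ x → δ _≟_ c x ℤ.* f x) ≡ f c
  sum-δ-in (x ∷ l) (x∉l ∷ _) (here refl) f with x ≟ x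
  ... | no x≢x = contradiction refl x≢x
  ... | yes _  = trans (cong₂ ℤ._+_ (ℤP.*-identityˡ (f x))
                                    (sum-δ-absent l (λ x∈l → All.lookup x∉l x∈l refl) f))
                       (ℤP.+-identityʳ (f x))
  sum-δ-in (x ∷ l) (x∉l ∷ l-unique) {c} (there c∈l) f with c ≟ x
  ... | yes refl = contradiction refl (All.lookup x∉l c∈l)
  ... | no _     = trans (cong (λ v → v ℤ.+ sumOver l (λ y → δ _≟_ c y ℤ.* f y)) (ℤP.*-zeroˡ (f x)))
                         (trans (ℤP.+-identityˡ _) (sum-δ-in l l-unique c∈l f))

  sum-δ : ∀ c (f : V → ℤ) → sumOver vs (λ x → δ _≟_ c x ℤ.* f x) ≡ f c
  sum-δ c = sum-δ-in vs vs-unique (vs-complete c)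

  reindex : ∀ (g h : V → V) → (∀ x → g (h x) ≡ x) → (∀ x → h (g x) ≡ x) →
            ∀ (f : V → ℤ) → sumOver vs (f ∘ g) ≡ sumOver vs f
  reindex g h gh hg f = begin
    sumOver vs (f ∘ g)
      ≡⟨ sum-cong vs (λ x → sym (sum-δ (g x) f)) ⟩
    sumOver vs (λ x → sumOver vs (λ y → δ _≟_ (g x) y ℤ.* f y))
      ≡⟨ sum-swap vs vs (λ x y → δ _≟_ (g x) y ℤ.* f y) ⟩
    sumOver vs (λ y → sumOver vs (λ x → δ _≟_ (g x) y ℤ.* f y))
      ≡⟨ sum-cong vs (λ y → sum-cong vs (λ x → cong (ℤ._* f y) (δ-flip x y))) ⟩
    sumOver vs (λ y → sumOver vs (λ x → δ _≟_ (h y) x ℤ.* f y))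
      ≡⟨ sum-cong vs (λ y → sum-δ (h y) (λ _ → f y)) ⟩
    sumOver vs f ∎
    where
      open ≡-Reasoning
      δ-flip : ∀ x y → δ _≟_ (g x) y ≡ δ _≟_ (h y) x
      δ-flip x y = 𝟙-cong (g x ≟ y) (h y ≟ x) (λ { refl → hg x }) (λ { refl → gh y })

  lookup-injective : ∀ {l : List V} → Unique l → ∀ i j → lookup l i ≡ lookup l j → i ≡ j
  lookup-injective (_ ∷ _)         Fin.zero    Fin.zero    _  = refl
  lookup-injective (x∉l ∷ _)       Fin.zero    (Fin.suc j) eq = contradiction eq (All.lookup x∉l (∈-lookup j))
  lookup-injective (x∉l ∷ _)       (Fin.suc i) Fin.zero    eq = contradiction (sym eq) (All.lookup x∉l (∈-lookup i))
  lookup-injective (_ ∷ l-unique) (Fin.suc i) (Fin.suc j) eq = cong Fin.suc (lookup-injective l-unique i j eq)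

  position : V → Fin (length vs)
  position v = Any.index (vs-complete v)

  position-injective : ∀ u v → position u ≡ position v → u ≡ v
  position-injective u v eq = begin
    u                      ≡⟨ lookup-index (vs-complete u) ⟩
    lookup vs (position u) ≡⟨ cong (lookup vs) eq ⟩
    lookup vs (position v) ≡⟨ lookup-index (vs-complete v) ⟨
    v                      ∎
    where open ≡-Reasoning

  injection-bound : ∀ {k} (G : V → Fin k) → (∀ u v → G u ≡ G v → u ≡ v) → length vs ℕ.≤ k
  injection-bound {k} G G-injective with k ℕ.<? length vs
  ... | no k≮length = ℕP.≮⇒≥ k≮length
  ... | yes k<length with FinP.pigeonhole k<length (G ∘ lookup vs)
  ... | i , j , i<j , Gi≡Gj =
    contradiction (lookup-injective vs-unique i j (G-injective _ _ Gi≡Gj)) (FinP.<⇒≢ i<j)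

  module _ {n : ℕ} (length≡ : length vs ≡ suc n) where

    private
      pos : V → Fin (suc n)
      pos v = Fin.cast length≡ (position v)

      pos-injective : ∀ u v → pos u ≡ pos v → u ≡ v
      pos-injective u v eq = position-injective u v (begin
        position u                     ≡⟨ FinP.cast-involutive (sym length≡) length≡ (position u) ⟨
        Fin.cast (sym length≡) (pos u) ≡⟨ cong (Fin.cast (sym length≡)) eq ⟩
        Fin.cast (sym length≡) (pos v) ≡⟨ FinP.cast-involutive (sym length≡) length≡ (position v) ⟩
        position v                     ∎)
        where open ≡-Reasoning

    collision : ∀ c (f : Fin (suc n) → V) → (∀ i → f i ≢ c) →
                ∃₂ λ i j → i Fin.< j × f i ≡ f j
    collision c f avoids-c with FinP.pigeonhole (ℕP.n<1+n n) punched
      where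
        punched : Fin (suc n) → Fin n
        punched k = Fin.punchOut {i = pos c} (λ eq → avoids-c k (sym (pos-injective c (f k) eq)))
    ... | i , j , i<j , eq = i , j , i<j , pos-injective (f i) (f j) (FinP.punchOut-injective {i = pos c} _ _ eq)

parity-double : ∀ k → parity (k ℕ.* 2) ≡ 0ℙ
parity-double k = trans (ℙP.*-homo-* k 2) (ℙP.*-zeroʳ (parity k))

even⇒double : ∀ r → parity r ≡ 0ℙ → ∃[ k ] r ≡ k ℕ.* 2
even⇒double zero          _    = 0 , refl
even⇒double (suc (suc r)) even with even⇒double r even
... | k , r≡2k = suc k , cong (suc ∘ suc) r≡2k

parity-flip : ∀ a i → parity a ≡ 1ℙ → parity (a ℕ.+ i) ≡ parity i ⁻¹
parity-flip a i a-odd = trans (ℙP.+-homo-+ a i) (cong (ℙ._+ parity i) a-odd)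

parity-mod-even : ∀ i n .{{_ : NonZero n}} → parity n ≡ 0ℙ → parity (i ℕ.% n) ≡ parity i
parity-mod-even i n n-even = sym (begin
  parity i                                              ≡⟨ cong parity (m≡m%n+[m/n]*n i n) ⟩
  parity (i ℕ.% n ℕ.+ (i / n) ℕ.* n)                    ≡⟨ ℙP.+-homo-+ (i ℕ.% n) _ ⟩
  parity (i ℕ.% n) ℙ.+ parity ((i / n) ℕ.* n)           ≡⟨ cong (parity (i ℕ.% n) ℙ.+_) (ℙP.*-homo-* (i / n) n) ⟩
  parity (i ℕ.% n) ℙ.+ (parity (i / n) ℙ.* parity n)    ≡⟨ cong (λ p → parity (i ℕ.% n) ℙ.+ (parity (i / n) ℙ.* p)) n-even ⟩
  parity (i ℕ.% n) ℙ.+ (parity (i / n) ℙ.* 0ℙ)          ≡⟨ cong (parity (i ℕ.% n) ℙ.+_) (ℙP.*-zeroʳ (parity (i / n))) ⟩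
  parity (i ℕ.% n) ℙ.+ 0ℙ                               ≡⟨ ℙP.+-identityʳ _ ⟩
  parity (i ℕ.% n)                                      ∎)
  where open ≡-Reasoning

mod4≡3⇒odd : ∀ m → (2 ℕ.* m ℕ.+ 1) ℕ.% 4 ≡ 3 → parity m ≡ 1ℙ
mod4≡3⇒odd (suc zero)    _   = refl
mod4≡3⇒odd (suc (suc k)) ≡3 = mod4≡3⇒odd k (trans (sym drop-4) ≡3)
  where
    shift : ∀ k → 2 ℕ.* suc (suc k) ℕ.+ 1 ≡ 2 ℕ.* k ℕ.+ 1 ℕ.+ 1 ℕ.* 4
    shift = ℕSolver.solve-∀
    drop-4 : (2 ℕ.* suc (suc k) ℕ.+ 1) ℕ.% 4 ≡ (2 ℕ.* k ℕ.+ 1) ℕ.% 4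
    drop-4 = trans (cong (ℕ._% 4) (shift k)) ([m+kn]%n≡m%n (2 ℕ.* k ℕ.+ 1) 1 4)

module FieldFacts (F : FiniteField) where

  open FiniteField F public
  open IsCommutativeRing isCommutativeRing public
    using (*-comm; *-assoc; *-identityˡ; *-identityʳ; zeroʳ; +-comm; distribˡ; distribʳ; -‿inverseʳ)

  ring : CommutativeRing 0ℓ 0ℓ
  ring = record { isCommutativeRing = isCommutativeRing }

  open import Algebra.Properties.Ring (CommutativeRing.ring ring) public
    using (-1*x≈-x; x[y-z]≈xy-xz)
  open import Algebra.Properties.AbelianGroup (CommutativeRing.+-abelianGroup ring) public
    using (inverseˡ-unique; x∙y⁻¹≈ε⇒x≈y; x≈y⇒x∙y⁻¹≈ε; ε⁻¹≈ε; ⁻¹-involutive; ⁻¹-anti-homo‿-;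
           //-rightDividesˡ; //-rightDividesʳ)

  infixl 6 _-_
  _-_ : Carrier → Carrier → Carrier
  x - y = x + - y

  no-zero-divisors : ∀ x y → x * y ≡ 0# → x ≡ 0# ⊎ y ≡ 0#
  no-zero-divisors x y xy≡0 with x ≟ 0#
  ... | yes x≡0 = inj₁ x≡0
  ... | no  x≢0 with inverse x x≢0
  ... | x⁻¹ , xx⁻¹≡1 = inj₂ (begin
    y              ≡⟨ *-identityˡ y ⟨
    1# * y         ≡⟨ cong (_* y) (trans (sym xx⁻¹≡1) (*-comm x x⁻¹)) ⟩
    x⁻¹ * x * y    ≡⟨ *-assoc x⁻¹ x y ⟩
    x⁻¹ * (x * y)  ≡⟨ cong (x⁻¹ *_) xy≡0 ⟩
    x⁻¹ * 0#       ≡⟨ zeroʳ x⁻¹ ⟩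
    0#             ∎)
    where open ≡-Reasoning

  *-nonzero : ∀ x y → x ≢ 0# → y ≢ 0# → x * y ≢ 0#
  *-nonzero x y x≢0 y≢0 xy≡0 = [ x≢0 , y≢0 ] (no-zero-divisors x y xy≡0)

  *-cancelˡ : ∀ c x y → c ≢ 0# → c * x ≡ c * y → x ≡ y
  *-cancelˡ c x y c≢0 cx≡cy = x∙y⁻¹≈ε⇒x≈y x y ([ (λ c≡0 → contradiction c≡0 c≢0) , id ]
    (no-zero-divisors c (x - y) (trans (x[y-z]≈xy-xz c x y) (x≈y⇒x∙y⁻¹≈ε cx≡cy))))

  square-root-of-one : ∀ x → x * x ≡ 1# → x ≢ 1# → x ≡ - 1#
  square-root-of-one x xx≡1 x≢1 with no-zero-divisors (x - 1#) (x + 1#) factorised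
    where
      factorised : (x - 1#) * (x + 1#) ≡ 0#
      factorised = begin
        (x - 1#) * (x + 1#)                ≡⟨ distribʳ (x + 1#) x (- 1#) ⟩
        x * (x + 1#) + - 1# * (x + 1#)     ≡⟨ cong₂ _+_ (distribˡ x x 1#) (-1*x≈-x (x + 1#)) ⟩
        (x * x + x * 1#) - (x + 1#)        ≡⟨ cong (_- (x + 1#)) (cong₂ _+_ xx≡1 (*-identityʳ x)) ⟩
        (1# + x) - (x + 1#)                ≡⟨ cong (_- (x + 1#)) (+-comm 1# x) ⟩
        (x + 1#) - (x + 1#)                ≡⟨ -‿inverseʳ (x + 1#) ⟩
        0#                                 ∎
        where open ≡-Reasoning
  ... | inj₁ x-1≡0 = contradiction (x∙y⁻¹≈ε⇒x≈y x 1# x-1≡0) x≢1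
  ... | inj₂ x+1≡0 = inverseˡ-unique x 1# x+1≡0

  ^-+ : ∀ x i j → x ^ (i ℕ.+ j) ≡ x ^ i * x ^ j
  ^-+ x zero    j = sym (*-identityˡ _)
  ^-+ x (suc i) j = trans (cong (x *_) (^-+ x i j)) (sym (*-assoc x _ _))

  ^-* : ∀ x i j → x ^ (j ℕ.* i) ≡ (x ^ i) ^ j
  ^-* x i zero    = refl
  ^-* x i (suc j) = trans (^-+ x i (j ℕ.* i)) (cong (x ^ i *_) (^-* x i j))

  1^ : ∀ j → 1# ^ j ≡ 1#
  1^ zero    = refl
  1^ (suc j) = trans (*-identityˡ _) (1^ j)

  ^-nonzero : ∀ x i → x ≢ 0# → x ^ i ≢ 0#
  ^-nonzero x zero    x≢0 1≡0 = 0≢1 (sym 1≡0)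
  ^-nonzero x (suc i) x≢0     = *-nonzero x (x ^ i) x≢0 (^-nonzero x i x≢0)

  open Enumeration _≟_ elements elements-unique elements-complete public

  Σ : (Carrier → ℤ) → ℤ
  Σ = sumOver elements

  Σ-translate : ∀ c (f : Carrier → ℤ) → Σ (λ z → f (z - c)) ≡ Σ f
  Σ-translate c = reindex (_- c) (_+ c) (λ z → //-rightDividesʳ c z) (λ z → //-rightDividesˡ c z)

  reflect-involutive : ∀ x z → x - (x - z) ≡ z
  reflect-involutive x z = begin
    x - (x - z)   ≡⟨ cong (x +_) (⁻¹-anti-homo‿- x z) ⟩
    x + (z - x)   ≡⟨ +-comm x (z - x) ⟩
    (z - x) + x   ≡⟨ //-rightDividesˡ x z ⟩
    z             ∎
    where open ≡-Reasoning

  Σ-reflect : ∀ x (f : Carrier → ℤ) → Σ (λ z → f (x - z)) ≡ Σ f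
  Σ-reflect x = reindex (λ z → x - z) (λ z → x - z) (reflect-involutive x) (reflect-involutive x)

  Σ-negate : ∀ (f : Carrier → ℤ) → Σ (λ z → f (- z)) ≡ Σ f
  Σ-negate = reindex -_ -_ ⁻¹-involutive ⁻¹-involutive

  Σ-scale : ∀ σ p → p * σ ≡ 1# → ∀ (f : Carrier → ℤ) → Σ (λ z → f (σ * z)) ≡ Σ f
  Σ-scale σ p pσ≡1 = reindex (σ *_) (p *_) (cancels σ p (trans (*-comm σ p) pσ≡1)) (cancels p σ pσ≡1)
    where
      cancels : ∀ u v → u * v ≡ 1# → ∀ z → u * (v * z) ≡ z
      cancels u v uv≡1 z = trans (sym (*-assoc u v z)) (trans (cong (_* z) uv≡1) (*-identityˡ z))

-- A primitive element α of a field with n + 1 elements has multiplicative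
-- order exactly n: some power α^d with 0 < d ≤ n is 1 (pigeonhole on the
-- powers of α), and no d < n works (otherwise x ↦ log x mod d would inject
-- F into a set of d + 1 < n + 1 elements).
module PrimitiveOrder (F : FiniteField) (n : ℕ) .⦃ _ : NonZero n ⦄
                      (order≡ : FiniteField.order F ≡ suc n)
                      (α : FiniteField.Carrier F) (α-primitive : FiniteField.IsPrimitive F α) where

  open FieldFacts F

  α≢0 : α ≢ 0#
  α≢0 = proj₁ α-primitive

  log : ∀ x → x ≢ 0# → ℕ
  log x x≢0 = proj₁ (proj₂ α-primitive x x≢0)

  α^log : ∀ x (x≢0 : x ≢ 0#) → α ^ log x x≢0 ≡ x
  α^log x x≢0 = proj₂ (proj₂ α-primitive x x≢0)

  ^-cancel : ∀ i d → α ^ (i ℕ.+ d) ≡ α ^ i → α ^ d ≡ 1#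
  ^-cancel i d α^[i+d]≡α^i = *-cancelˡ (α ^ i) (α ^ d) 1# (^-nonzero α i α≢0)
    (trans (sym (^-+ α i d)) (trans α^[i+d]≡α^i (sym (*-identityʳ _))))

  period-from-collision : ∀ i j → i ℕ.< j → α ^ i ≡ α ^ j → α ^ (j ∸ i) ≡ 1#
  period-from-collision i j i<j α^i≡α^j =
    ^-cancel i (j ∸ i) (trans (cong (α ^_) (ℕP.m+[n∸m]≡n (ℕP.<⇒≤ i<j))) (sym α^i≡α^j))

  some-period : ∃[ d ] (0 ℕ.< d × d ℕ.≤ n × α ^ d ≡ 1#)
  some-period with collision order≡ 0# (λ k → α ^ toℕ k) (λ k → ^-nonzero α (toℕ k) α≢0)
  ... | i , j , i<j , α^i≡α^j =
    toℕ j ∸ toℕ i ,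
    ℕP.m<n⇒0<n∸m i<j ,
    ℕP.≤-trans (ℕP.m∸n≤m (toℕ j) (toℕ i)) (ℕP.≤-pred (FinP.toℕ<n j)) ,
    period-from-collision (toℕ i) (toℕ j) i<j α^i≡α^j

  reduce : ∀ d .⦃ _ : NonZero d ⦄ → α ^ d ≡ 1# → ∀ k → α ^ k ≡ α ^ (k ℕ.% d)
  reduce d α^d≡1 k = begin
    α ^ k                                 ≡⟨ cong (α ^_) (m≡m%n+[m/n]*n k d) ⟩
    α ^ (k ℕ.% d ℕ.+ (k / d) ℕ.* d)       ≡⟨ ^-+ α (k ℕ.% d) _ ⟩
    α ^ (k ℕ.% d) * α ^ ((k / d) ℕ.* d)   ≡⟨ cong (α ^ (k ℕ.% d) *_) (^-* α d (k / d)) ⟩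
    α ^ (k ℕ.% d) * (α ^ d) ^ (k / d)     ≡⟨ cong (λ u → α ^ (k ℕ.% d) * u ^ (k / d)) α^d≡1 ⟩
    α ^ (k ℕ.% d) * 1# ^ (k / d)          ≡⟨ cong (α ^ (k ℕ.% d) *_) (1^ (k / d)) ⟩
    α ^ (k ℕ.% d) * 1#                    ≡⟨ *-identityʳ _ ⟩
    α ^ (k ℕ.% d)                         ∎
    where open ≡-Reasoning

  no-short-period : ∀ d → 0 ℕ.< d → d ℕ.< n → α ^ d ≢ 1#
  no-short-period d 0<d d<n α^d≡1 =
    ℕP.<⇒≱ (ℕ.s≤s d<n) (subst (ℕ._≤ suc d) order≡ (injection-bound logMod logMod-injective))
    where
      instance
        d≢0 : NonZero d
        d≢0 = ℕ.>-nonZero 0<d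
      logMod : Carrier → Fin (suc d)
      logMod x with x ≟ 0#
      ... | yes _   = Fin.zero
      ... | no  x≢0 = Fin.suc (Fin.fromℕ< (m%n<n (log x x≢0) d))
      logMod-injective : ∀ x y → logMod x ≡ logMod y → x ≡ y
      logMod-injective x y eq with x ≟ 0# | y ≟ 0#
      ... | yes x≡0 | yes y≡0 = trans x≡0 (sym y≡0)
      ... | no  x≢0 | no  y≢0 = begin
        x                              ≡⟨ α^log x x≢0 ⟨
        α ^ log x x≢0                  ≡⟨ reduce d α^d≡1 (log x x≢0) ⟩
        α ^ (log x x≢0 ℕ.% d)          ≡⟨ cong (α ^_) same-residue ⟩
        α ^ (log y y≢0 ℕ.% d)          ≡⟨ reduce d α^d≡1 (log y y≢0) ⟨
        α ^ log y y≢0                  ≡⟨ α^log y y≢0 ⟩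
        y                              ∎
        where
          open ≡-Reasoning
          same-residue : log x x≢0 ℕ.% d ≡ log y y≢0 ℕ.% d
          same-residue = trans (sym (FinP.toℕ-fromℕ< _))
                               (trans (cong toℕ (FinP.suc-injective eq)) (FinP.toℕ-fromℕ< _))

  α^n≡1 : α ^ n ≡ 1#
  α^n≡1 with some-period
  ... | d , 0<d , d≤n , α^d≡1 with ℕP.m≤n⇒m<n∨m≡n d≤n
  ... | inj₁ d<n  = contradiction α^d≡1 (no-short-period d 0<d d<n)
  ... | inj₂ refl = α^d≡1

  ^-injective-mod : ∀ i j → α ^ i ≡ α ^ j → i ℕ.% n ≡ j ℕ.% n
  ^-injective-mod i j α^i≡α^j =
    equal-residues (i ℕ.% n) (j ℕ.% n) (m%n<n i n) (m%n<n j n)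
      (trans (sym (reduce n α^n≡1 i)) (trans α^i≡α^j (reduce n α^n≡1 j)))
    where
      distinct : ∀ r s → r ℕ.< s → s ℕ.< n → α ^ r ≢ α ^ s
      distinct r s r<s s<n α^r≡α^s =
        no-short-period (s ∸ r) (ℕP.m<n⇒0<n∸m r<s) (ℕP.≤-<-trans (ℕP.m∸n≤m s r) s<n)
          (period-from-collision r s r<s α^r≡α^s)
      equal-residues : ∀ r s → r ℕ.< n → s ℕ.< n → α ^ r ≡ α ^ s → r ≡ s
      equal-residues r s r<n s<n α^r≡α^s with ℕP.<-cmp r s
      ... | tri< r<s _ _ = contradiction α^r≡α^s (distinct r s r<s s<n)
      ... | tri≈ _ r≡s _ = r≡s
      ... | tri> _ _ s<r = contradiction (sym α^r≡α^s) (distinct s r s<r r<n)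

-- Character sums of a "skew" set D ⊆ F*, i.e. one with F* = D ⊎ (-D); here D
-- is given by its indicator χ.  (For q ≡ 3 mod 4, D_0^2 is such a set.)  The
-- identity skew-sum is the heart of the directed strongly regular structure.
module SkewSet (F : FiniteField) (χ : FiniteField.Carrier F → ℤ)
               (χ-zero : χ (FiniteField.0# F) ≡ ℤ.+ 0)
               (χ-skew : ∀ t → t ≢ FiniteField.0# F → χ t ℤ.+ χ (FiniteField.-_ F t) ≡ ℤ.+ 1) where

  open FieldFacts F

  χ-pair : ∀ u → χ u ℤ.+ χ (- u) ≡ ℤ.+ 1 ℤ.- δ _≟_ 0# u
  χ-pair u with 0# ≟ u
  ... | yes refl = cong₂ ℤ._+_ χ-zero (trans (cong χ ε⁻¹≈ε) χ-zero)
  ... | no  0≢u  = χ-skew u (0≢u ∘ sym)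

  size-twice : Σ χ ℤ.+ Σ χ ≡ ℤ.+ order ℤ.- ℤ.+ 1
  size-twice = begin
    Σ χ ℤ.+ Σ χ                                    ≡⟨ cong (λ s → Σ χ ℤ.+ s) (Σ-negate χ) ⟨
    Σ χ ℤ.+ Σ (λ u → χ (- u))                      ≡⟨ sum-+ elements χ (λ u → χ (- u)) ⟨
    Σ (λ u → χ u ℤ.+ χ (- u))                      ≡⟨ sum-cong elements χ-pair ⟩
    Σ (λ u → ℤ.+ 1 ℤ.- δ _≟_ 0# u)                 ≡⟨ sum-+ elements (λ _ → ℤ.+ 1) (λ u → ℤ.- δ _≟_ 0# u) ⟩
    Σ (λ _ → ℤ.+ 1) ℤ.+ Σ (λ u → ℤ.- δ _≟_ 0# u)   ≡⟨ cong₂ ℤ._+_ (sum-const-one elements) (sum-neg elements (δ _≟_ 0#)) ⟩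
    ℤ.+ order ℤ.- Σ (δ _≟_ 0#)                     ≡⟨ cong (λ s → ℤ.+ order ℤ.- s) count-zero ⟩
    ℤ.+ order ℤ.- ℤ.+ 1                            ∎
    where
      open ≡-Reasoning
      count-zero : Σ (δ _≟_ 0#) ≡ ℤ.+ 1
      count-zero = trans (sum-cong elements (λ u → sym (ℤP.*-identityʳ (δ _≟_ 0# u))))
                         (sum-δ 0# (λ _ → ℤ.+ 1))

  χ-pair-at : ∀ z c → χ (z - c) ℤ.+ χ (c - z) ≡ ℤ.+ 1 ℤ.- δ _≟_ c z
  χ-pair-at z c = begin
    χ (z - c) ℤ.+ χ (c - z)         ≡⟨ cong (λ t → χ (z - c) ℤ.+ χ t) (⁻¹-anti-homo‿- z c) ⟨
    χ (z - c) ℤ.+ χ (- (z - c))     ≡⟨ χ-pair (z - c) ⟩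
    ℤ.+ 1 ℤ.- δ _≟_ 0# (z - c)      ≡⟨ cong (λ d → ℤ.+ 1 ℤ.- d) (𝟙-cong (0# ≟ (z - c)) (c ≟ z) 0≡z-c⇒c≡z c≡z⇒0≡z-c) ⟩
    ℤ.+ 1 ℤ.- δ _≟_ c z             ∎
    where
      open ≡-Reasoning
      0≡z-c⇒c≡z : 0# ≡ z - c → c ≡ z
      0≡z-c⇒c≡z 0≡z-c = sym (x∙y⁻¹≈ε⇒x≈y z c (sym 0≡z-c))
      c≡z⇒0≡z-c : c ≡ z → 0# ≡ z - c
      c≡z⇒0≡z-c refl = sym (-‿inverseʳ c)

  skew-sum : ∀ x c → Σ (λ z → χ (x - z) ℤ.* χ (z - c)) ℤ.+ Σ (λ z → χ (x - z) ℤ.* χ (c - z))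
                     ≡ Σ χ ℤ.- χ (x - c)
  skew-sum x c = begin
    Σ (λ z → χ (x - z) ℤ.* χ (z - c)) ℤ.+ Σ (λ z → χ (x - z) ℤ.* χ (c - z))
      ≡⟨ sum-+ elements (λ z → χ (x - z) ℤ.* χ (z - c)) (λ z → χ (x - z) ℤ.* χ (c - z)) ⟨
    Σ (λ z → χ (x - z) ℤ.* χ (z - c) ℤ.+ χ (x - z) ℤ.* χ (c - z))
      ≡⟨ sum-cong elements (λ z → trans (sym (ℤP.*-distribˡ-+ (χ (x - z)) _ _))
                                        (cong (χ (x - z) ℤ.*_) (χ-pair-at z c))) ⟩
    Σ (λ z → χ (x - z) ℤ.* (ℤ.+ 1 ℤ.- δ _≟_ c z))
      ≡⟨ sum-cong elements (λ z → expand (χ (x - z)) (δ _≟_ c z)) ⟩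
    Σ (λ z → χ (x - z) ℤ.- δ _≟_ c z ℤ.* χ (x - z))
      ≡⟨ sum-+ elements (λ z → χ (x - z)) (λ z → ℤ.- (δ _≟_ c z ℤ.* χ (x - z))) ⟩
    Σ (λ z → χ (x - z)) ℤ.+ Σ (λ z → ℤ.- (δ _≟_ c z ℤ.* χ (x - z)))
      ≡⟨ cong₂ ℤ._+_ (Σ-reflect x χ) (sum-neg elements (λ z → δ _≟_ c z ℤ.* χ (x - z))) ⟩
    Σ χ ℤ.- Σ (λ z → δ _≟_ c z ℤ.* χ (x - z))
      ≡⟨ cong (λ s → Σ χ ℤ.- s) (sum-δ c (λ z → χ (x - z))) ⟩
    Σ χ ℤ.- χ (x - c) ∎
    where
      open ≡-Reasoning
      expand : ∀ a d → a ℤ.* (ℤ.+ 1 ℤ.- d) ≡ a ℤ.- d ℤ.* a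
      expand = solve-∀

module QuadraticCharacter (F : FiniteField) (m : ℕ) .⦃ _ : NonZero m ⦄
                          (order≡ : FiniteField.order F ≡ 2 ℕ.* m ℕ.+ 1)
                          (α : FiniteField.Carrier F) (α-primitive : FiniteField.IsPrimitive F α) where

  open FieldFacts F

  n : ℕ
  n = 2 ℕ.* m

  instance
    n≢0 : NonZero n
    n≢0 = ℕP.m*n≢0 2 m

  open PrimitiveOrder F n (trans order≡ (ℕP.+-comm n 1)) α α-primitive public

  parity-n : parity n ≡ 0ℙ
  parity-n = ℙP.*-homo-* 2 m

  IsSquare : Carrier → Set
  IsSquare t = Any (λ k → t ≡ (α ^ 2) ^ k) (upTo (order ∸ 1))

  isSquare? : ∀ t → Dec (IsSquare t)
  isSquare? t = Any.any? (λ k → t ≟ ((α ^ 2) ^ k)) (upTo (order ∸ 1))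

  χ : Carrier → ℤ
  χ t = 𝟙 (isSquare? t)

  square⇒even : ∀ i → IsSquare (α ^ i) → parity i ≡ 0ℙ
  square⇒even i i-square with Any.satisfied i-square
  ... | k , α^i≡α^2^k = begin
    parity i                     ≡⟨ parity-mod-even i n parity-n ⟨
    parity (i ℕ.% n)             ≡⟨ cong parity (^-injective-mod i (k ℕ.* 2) (trans α^i≡α^2^k (sym (^-* α 2 k)))) ⟩
    parity ((k ℕ.* 2) ℕ.% n)     ≡⟨ parity-mod-even (k ℕ.* 2) n parity-n ⟩
    parity (k ℕ.* 2)             ≡⟨ parity-double k ⟩
    0ℙ                           ∎
    where open ≡-Reasoning

  even⇒square : ∀ i → parity i ≡ 0ℙ → IsSquare (α ^ i)
  even⇒square i i-even with even⇒double (i ℕ.% n) (trans (parity-mod-even i n parity-n) i-even)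
  ... | k , i%n≡2k = Any.map (λ { refl → α^i≡α^2^k }) (∈-upTo⁺ k<q-1)
    where
      α^i≡α^2^k : α ^ i ≡ (α ^ 2) ^ k
      α^i≡α^2^k = trans (reduce n α^n≡1 i) (trans (cong (α ^_) i%n≡2k) (^-* α 2 k))
      k<q-1 : k ℕ.< order ∸ 1
      k<q-1 = subst (k ℕ.<_) (sym (trans (cong (_∸ 1) order≡) (ℕP.m+n∸n≡m n 1)))
                (ℕP.≤-<-trans (ℕP.m≤m*n k 2) (subst (ℕ._< n) i%n≡2k (m%n<n i n)))

  χ-pow : ∀ i → χ (α ^ i) ≡ 𝟙 (parity i ℙP.≟ 0ℙ)
  χ-pow i = 𝟙-cong (isSquare? (α ^ i)) (parity i ℙP.≟ 0ℙ) (square⇒even i) (even⇒square i)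

  χ-zero : χ 0# ≡ ℤ.+ 0
  χ-zero = 𝟙-cong (isSquare? 0#) (no λ ()) zero-not-square λ ()
    where
      zero-not-square : IsSquare 0# → ⊥
      zero-not-square zero-square with Any.satisfied zero-square
      ... | k , 0≡α^2^k = ^-nonzero (α ^ 2) k (^-nonzero α 2 α≢0) (sym 0≡α^2^k)

  on-powers : ∀ (P : Carrier → Set) → (∀ i → P (α ^ i)) → ∀ t → t ≢ 0# → P t
  on-powers P P-pow t t≢0 = subst P (α^log t t≢0) (P-pow (log t t≢0))

  χ-parity : ∀ i j → parity i ≡ parity j → χ (α ^ i) ≡ χ (α ^ j)
  χ-parity i j same = trans (χ-pow i) (trans (cong (λ p → 𝟙 (p ℙP.≟ 0ℙ)) same) (sym (χ-pow j)))

  -- α^m = -1: its square is α^n = 1, yet it is not 1 because m < n.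
  α^m≡-1 : α ^ m ≡ - 1#
  α^m≡-1 = square-root-of-one (α ^ m) α^m-squared
             (no-short-period m (ℕ.>-nonZero⁻¹ m) (ℕP.m<m+n m (ℕP.<-≤-trans (ℕ.>-nonZero⁻¹ m) (ℕP.m≤m+n m 0))))
    where
      α^m-squared : α ^ m * α ^ m ≡ 1#
      α^m-squared = trans (sym (^-+ α m m)) (trans (cong (λ k → α ^ (m ℕ.+ k)) (sym (ℕP.+-identityʳ m))) α^n≡1)

  -α^i : ∀ i → - (α ^ i) ≡ α ^ (m ℕ.+ i)
  -α^i i = begin
    - (α ^ i)          ≡⟨ -1*x≈-x (α ^ i) ⟨
    - 1# * α ^ i       ≡⟨ cong (_* α ^ i) α^m≡-1 ⟨
    α ^ m * α ^ i      ≡⟨ ^-+ α m i ⟨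
    α ^ (m ℕ.+ i)      ∎
    where open ≡-Reasoning

  C-entry : ∀ σ x y → C α 2 σ x y ≡ χ (x - σ * y)
  C-entry σ x y = 𝟙-cong (inShiftedD0? α 2 σ x y) (isSquare? (x - σ * y)) (Any.map to) (Any.map from)
    where
      to : ∀ {u} → x ≡ σ * y + u → x - σ * y ≡ u
      to {u} refl = trans (cong (_- σ * y) (+-comm (σ * y) u)) (//-rightDividesʳ (σ * y) u)
      from : ∀ {u} → x - σ * y ≡ u → x ≡ σ * y + u
      from refl = trans (sym (//-rightDividesˡ (σ * y) x)) (+-comm (x - σ * y) (σ * y))

  module _ (m-odd : parity m ≡ 1ℙ) where

    -- Exactly one of t, -t is a square (t ≠ 0), since -t = α^(m+i) flips parity.
    χ-skew : ∀ t → t ≢ 0# → χ t ℤ.+ χ (- t) ≡ ℤ.+ 1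
    χ-skew = on-powers (λ t → χ t ℤ.+ χ (- t) ≡ ℤ.+ 1) λ i → begin
      χ (α ^ i) ℤ.+ χ (- (α ^ i))                        ≡⟨ cong (λ t → χ (α ^ i) ℤ.+ χ t) (-α^i i) ⟩
      χ (α ^ i) ℤ.+ χ (α ^ (m ℕ.+ i))                    ≡⟨ cong₂ ℤ._+_ (χ-pow i) (χ-pow (m ℕ.+ i)) ⟩
      𝟙 (parity i ℙP.≟ 0ℙ) ℤ.+ 𝟙 (parity (m ℕ.+ i) ℙP.≟ 0ℙ)
        ≡⟨ cong (λ p → 𝟙 (parity i ℙP.≟ 0ℙ) ℤ.+ 𝟙 (p ℙP.≟ 0ℙ)) (parity-flip m i m-odd) ⟩
      𝟙 (parity i ℙP.≟ 0ℙ) ℤ.+ 𝟙 (parity i ⁻¹ ℙP.≟ 0ℙ)  ≡⟨ exactly-one-even (parity i) ⟩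
      ℤ.+ 1                                              ∎
      where
        open ≡-Reasoning
        exactly-one-even : ∀ p → 𝟙 (p ℙP.≟ 0ℙ) ℤ.+ 𝟙 (p ⁻¹ ℙP.≟ 0ℙ) ≡ ℤ.+ 1
        exactly-one-even 0ℙ = refl
        exactly-one-even 1ℙ = refl

    -- s = α^(1+2k) flips parity just as -1 = α^m does.
    χ-nonresidue : ∀ s → InClass α 2 1 s → ∀ t → χ (s * t) ≡ χ (- t)
    χ-nonresidue s s∈D₁ t with Any.satisfied s∈D₁ | t ≟ 0#
    ... | _ , _ | yes refl = cong χ (trans (zeroʳ s) (sym ε⁻¹≈ε))
    ... | k , s≡α·α^2^k | no t≢0 = on-powers (λ t → χ (s * t) ≡ χ (- t)) at-power t t≢0
      where
        s≡α^[1+2k] : s ≡ α ^ (1 ℕ.+ k ℕ.* 2)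
        s≡α^[1+2k] = trans s≡α·α^2^k (trans (cong (α ^ 1 *_) (sym (^-* α 2 k))) (sym (^-+ α 1 (k ℕ.* 2))))
        odd-exponent : parity (1 ℕ.+ k ℕ.* 2) ≡ 1ℙ
        odd-exponent = trans (ℙP.+-homo-+ 1 (k ℕ.* 2)) (cong (1ℙ ℙ.+_) (parity-double k))
        at-power : ∀ i → χ (s * α ^ i) ≡ χ (- (α ^ i))
        at-power i = begin
          χ (s * α ^ i)                 ≡⟨ cong (λ u → χ (u * α ^ i)) s≡α^[1+2k] ⟩
          χ (α ^ (1 ℕ.+ k ℕ.* 2) * α ^ i) ≡⟨ cong χ (^-+ α (1 ℕ.+ k ℕ.* 2) i) ⟨
          χ (α ^ (1 ℕ.+ k ℕ.* 2 ℕ.+ i)) ≡⟨ χ-parity (1 ℕ.+ k ℕ.* 2 ℕ.+ i) (m ℕ.+ i) (trans (parity-flip (1 ℕ.+ k ℕ.* 2) i odd-exponent) (sym (parity-flip m i m-odd))) ⟩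
          χ (α ^ (m ℕ.+ i))             ≡⟨ cong χ (-α^i i) ⟨
          χ (- (α ^ i))                 ∎
          where open ≡-Reasoning

    -- Scaling the summation variable by a non-square s (with inverse p)
    -- turns a "twisted" product sum into an untwisted one.
    twist : ∀ s p → InClass α 2 1 s → p * s ≡ 1# → ∀ x c d → s * c ≡ d →
            Σ (λ z → χ (x - p * z) ℤ.* χ (z - d)) ≡ Σ (λ z → χ (x - z) ℤ.* χ (c - z))
    twist s p s∈D₁ ps≡1 x c _ refl = begin
      Σ (λ z → χ (x - p * z) ℤ.* χ (z - s * c))
        ≡⟨ Σ-scale s p ps≡1 (λ z → χ (x - p * z) ℤ.* χ (z - s * c)) ⟨
      Σ (λ z → χ (x - p * (s * z)) ℤ.* χ (s * z - s * c))
        ≡⟨ sum-cong elements (λ z → cong₂ ℤ._*_ (cong (λ u → χ (x - u)) (p[sz]≡z z)) (χ-shifted z)) ⟩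
      Σ (λ z → χ (x - z) ℤ.* χ (c - z)) ∎
      where
        open ≡-Reasoning
        p[sz]≡z : ∀ z → p * (s * z) ≡ z
        p[sz]≡z z = trans (sym (*-assoc p s z)) (trans (cong (_* z) ps≡1) (*-identityˡ z))
        χ-shifted : ∀ z → χ (s * z - s * c) ≡ χ (c - z)
        χ-shifted z = begin
          χ (s * z - s * c)   ≡⟨ cong χ (x[y-z]≈xy-xz s z c) ⟨
          χ (s * (z - c))     ≡⟨ χ-nonresidue s s∈D₁ (z - c) ⟩
          χ (- (z - c))       ≡⟨ cong χ (⁻¹-anti-homo‿- z c) ⟩
          χ (c - z)           ∎

odd⇒nonZero : ∀ m → parity m ≡ 1ℙ → NonZero m
odd⇒nonZero (suc m) _ = ℕ.>-nonZero ℕ.z<s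

-- With (t, λ, μ) = (m, m - 1, m) the right-hand side t I + λ A + μ (J - I - A)
-- of the DSRG equation collapses to m J - A.
dsrg-right-hand-side : ∀ m .⦃ _ : NonZero m ⦄ (d a : ℤ) →
  ℤ.+ m ℤ.* d ℤ.+ ℤ.+ (m ∸ 1) ℤ.* a ℤ.+ ℤ.+ m ℤ.* (ℤ.+ 1 ℤ.- d ℤ.- a) ≡ ℤ.+ m ℤ.- a
dsrg-right-hand-side (suc k) d a = collapse (ℤ.+ k) d a
  where
    collapse : ∀ K d a → (ℤ.+ 1 ℤ.+ K) ℤ.* d ℤ.+ K ℤ.* a ℤ.+ (ℤ.+ 1 ℤ.+ K) ℤ.* (ℤ.+ 1 ℤ.- d ℤ.- a)
                         ≡ (ℤ.+ 1 ℤ.+ K) ℤ.- a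
    collapse = solve-∀

module BlockMatrix (F : FiniteField) (m : ℕ)
                   (order≡ : FiniteField.order F ≡ 2 ℕ.* m ℕ.+ 1) (m-odd : parity m ≡ 1ℙ)
                   (α : FiniteField.Carrier F) (α-primitive : FiniteField.IsPrimitive F α)
                   (a b : FiniteField.Carrier F)
                   (a∈D₁ : FiniteField.InClass F α 2 1 a) (b∈D₁ : FiniteField.InClass F α 2 1 b)
                   (ab≡1 : FiniteField._*_ F a b ≡ FiniteField.1# F) where

  instance
    m≢0 : NonZero m
    m≢0 = odd⇒nonZero m m-odd

  open FieldFacts F
  open QuadraticCharacter F m order≡ α α-primitive
  open SkewSet F χ χ-zero (χ-skew m-odd)

  ba≡1 : b * a ≡ 1#
  ba≡1 = trans (*-comm b a) ab≡1

  two-sizes : Σ χ ℤ.+ Σ χ ≡ ℤ.+ (2 ℕ.* m)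
  two-sizes = trans size-twice (trans (cong (λ k → ℤ.+ k ℤ.- ℤ.+ 1) order≡)
                (trans (cong (ℤ._- ℤ.+ 1) (ℤP.pos-+ (2 ℕ.* m) 1)) (cancel (ℤ.+ (2 ℕ.* m)))))
    where cancel : ∀ k → k ℤ.+ ℤ.+ 1 ℤ.- ℤ.+ 1 ≡ k
          cancel = solve-∀

  size : Σ χ ≡ ℤ.+ m
  size = ℤP.*-cancelˡ-≡ (ℤ.+ 2) (Σ χ) (ℤ.+ m)
           (trans (double (Σ χ)) (trans two-sizes (ℤP.pos-* 2 m)))
    where double : ∀ k → ℤ.+ 2 ℤ.* k ≡ k ℤ.+ k
          double = solve-∀

  M : Fin 2 → Fin 2 → Carrier
  M = mat2 1# a b 1#

  M-invertible : ∀ i j → ∃[ p ] p * M i j ≡ 1#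
  M-invertible Fin.zero           Fin.zero           = 1# , *-identityˡ 1#
  M-invertible Fin.zero           (Fin.suc Fin.zero) = b , ba≡1
  M-invertible (Fin.suc Fin.zero) Fin.zero           = a , ab≡1
  M-invertible (Fin.suc Fin.zero) (Fin.suc Fin.zero) = 1# , *-identityˡ 1#

  A : Fin 2 × Carrier → Fin 2 × Carrier → ℤ
  A = blockC α 2 M

  entry : ∀ i x j y → A (i , x) (j , y) ≡ χ (x - M i j * y)
  entry i x j y = C-entry (M i j) x y

  Σ-blocks : ∀ (g : Fin 2 × Carrier → ℤ) →
    sumOver (blockVertices 2) g ≡ Σ (λ z → g (Fin.zero , z)) ℤ.+ Σ (λ z → g (Fin.suc Fin.zero , z))
  Σ-blocks g = begin
    sumOver (blockVertices 2) g
      ≡⟨ sum-++ (map (Fin.zero ,_) elements) _ g ⟩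
    sumOver (map (Fin.zero ,_) elements) g ℤ.+ sumOver (map (Fin.suc Fin.zero ,_) elements ++ []) g
      ≡⟨ cong (λ l → sumOver (map (Fin.zero ,_) elements) g ℤ.+ sumOver l g) (LP.++-identityʳ (map (Fin.suc Fin.zero ,_) elements)) ⟩
    sumOver (map (Fin.zero ,_) elements) g ℤ.+ sumOver (map (Fin.suc Fin.zero ,_) elements) g
      ≡⟨ cong₂ ℤ._+_ (sum-map (Fin.zero ,_) elements g) (sum-map (Fin.suc Fin.zero ,_) elements g) ⟩
    Σ (λ z → g (Fin.zero , z)) ℤ.+ Σ (λ z → g (Fin.suc Fin.zero , z)) ∎
    where open ≡-Reasoning

  untwisted : ∀ x c → Σ (λ z → χ (x - 1# * z) ℤ.* χ (z - c)) ≡ Σ (λ z → χ (x - z) ℤ.* χ (z - c))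
  untwisted x c = sum-cong elements (λ z → cong (λ u → χ (x - u) ℤ.* χ (z - c)) (*-identityˡ z))

  skew-sum′ : ∀ x c → Σ (λ z → χ (x - z) ℤ.* χ (c - z)) ℤ.+ Σ (λ z → χ (x - z) ℤ.* χ (z - c))
                      ≡ Σ χ ℤ.- χ (x - c)
  skew-sum′ x c = trans (ℤP.+-comm (Σ (λ z → χ (x - z) ℤ.* χ (c - z))) _) (skew-sum x c)

  -- (A²)_{(i,x),(j,w)} = m - A_{(i,x),(j,w)}: in each of the four block
  -- positions one block product is untwisted and the other is twisted by
  -- a or b, and the two combine by skew-sum.
  paths : ∀ i x j w → sumOver (blockVertices 2) (λ v → A (i , x) v ℤ.* A v (j , w)) ≡ Σ χ ℤ.- χ (x - M i j * w)
  paths i x j w = trans (Σ-blocks (λ v → A (i , x) v ℤ.* A v (j , w)))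
    (trans (cong₂ ℤ._+_ (sum-cong elements (λ z → cong₂ ℤ._*_ (entry i x _ z) (entry _ z j w)))
                        (sum-cong elements (λ z → cong₂ ℤ._*_ (entry i x _ z) (entry _ z j w))))
           (by-position i j))
    where
      by-position : ∀ i j →
        Σ (λ z → χ (x - M i Fin.zero * z) ℤ.* χ (z - M Fin.zero j * w)) ℤ.+
        Σ (λ z → χ (x - M i (Fin.suc Fin.zero) * z) ℤ.* χ (z - M (Fin.suc Fin.zero) j * w))
          ≡ Σ χ ℤ.- χ (x - M i j * w)
      by-position Fin.zero Fin.zero = trans
        (cong₂ ℤ._+_ (untwisted x (1# * w)) (twist m-odd b a b∈D₁ ab≡1 x (1# * w) (b * w) (cong (b *_) (*-identityˡ w))))
        (skew-sum x (1# * w))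
      by-position Fin.zero (Fin.suc Fin.zero) = trans
        (cong₂ ℤ._+_ (untwisted x (a * w)) (twist m-odd b a b∈D₁ ab≡1 x (a * w) (1# * w) (trans (sym (*-assoc b a w)) (cong (_* w) ba≡1))))
        (skew-sum x (a * w))
      by-position (Fin.suc Fin.zero) Fin.zero = trans
        (cong₂ ℤ._+_ (twist m-odd a b a∈D₁ ba≡1 x (b * w) (1# * w) (trans (sym (*-assoc a b w)) (cong (_* w) ab≡1))) (untwisted x (b * w)))
        (skew-sum′ x (b * w))
      by-position (Fin.suc Fin.zero) (Fin.suc Fin.zero) = trans
        (cong₂ ℤ._+_ (twist m-odd a b a∈D₁ ba≡1 x (1# * w) (a * w) (cong (a *_) (*-identityˡ w))) (untwisted x (1# * w)))
        (skew-sum′ x (1# * w))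

  row-block : ∀ i k x → Σ (λ z → A (i , x) (k , z)) ≡ Σ χ
  row-block i k x with M-invertible i k
  ... | p , pσ≡1 = trans (sum-cong elements (entry i x k))
                         (trans (Σ-scale (M i k) p pσ≡1 (λ u → χ (x - u))) (Σ-reflect x χ))

  column-block : ∀ k j w → Σ (λ z → A (k , z) (j , w)) ≡ Σ χ
  column-block k j w = trans (sum-cong elements (λ z → entry k z j w)) (Σ-translate (M k j * w) χ)

  number-of-vertices : length (blockVertices 2) ≡ 2 ℕ.* (2 ℕ.* m ℕ.+ 1)
  number-of-vertices = begin
    length (blockVertices 2)
      ≡⟨ LP.length-++ (block Fin.zero) {block (Fin.suc Fin.zero) ++ []} ⟩
    length (block Fin.zero) ℕ.+ length (block (Fin.suc Fin.zero) ++ [])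
      ≡⟨ cong₂ ℕ._+_ (block-length Fin.zero)
                     (trans (LP.length-++ (block (Fin.suc Fin.zero)) {[]})
                            (cong (ℕ._+ 0) (block-length (Fin.suc Fin.zero)))) ⟩
    2 ℕ.* order
      ≡⟨ cong (2 ℕ.*_) order≡ ⟩
    2 ℕ.* (2 ℕ.* m ℕ.+ 1) ∎
    where
      open ≡-Reasoning
      block : Fin 2 → List (Fin 2 × Carrier)
      block i = map (i ,_) elements
      block-length : ∀ i → length (block i) ≡ order
      block-length i = LP.length-map (i ,_) elements

  isDSRG : IsDSRG (vertexDec F 2) (blockVertices 2) A (2 ℕ.* (2 ℕ.* m ℕ.+ 1)) (2 ℕ.* m) m (m ∸ 1) m
  isDSRG = record
    { vertices-unique   = cartesianProduct⁺ (allFin⁺ 2) elements-unique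
    ; vertices-complete = λ { (i , x) → ∈-cartesianProduct⁺ (∈-allFin i) (elements-complete x) }
    ; num-vertices      = number-of-vertices
    ; zero-one          = λ { (i , x) (j , y) → 𝟙-zero-one (inShiftedD0? α 2 (M i j) x y) }
    ; square-eq         = λ { (i , x) (j , y) → trans (paths i x j y) (trans
                              (cong₂ (λ s e → s ℤ.- e) size (sym (entry i x j y)))
                              (sym (dsrg-right-hand-side m _ (A (i , x) (j , y))))) }
    ; row-sums          = λ { (i , x) → trans (Σ-blocks (A (i , x)))
                              (trans (cong₂ ℤ._+_ (row-block i Fin.zero x) (row-block i (Fin.suc Fin.zero) x)) two-sizes) }
    ; col-sums          = λ { (j , w) → trans (Σ-blocks (λ u → A u (j , w)))
                              (trans (cong₂ ℤ._+_ (column-block Fin.zero j w) (column-block (Fin.suc Fin.zero) j w)) two-sizes) }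
    }

open import Data.Nat using (_+_; _*_; _%_)
open FiniteField using (Carrier; order; IsPrimitive; InClass; blockVertices; blockC; 1#)

corollary5p3 :
    (F : FiniteField) →
    (m : ℕ) → IsPrimePower (order F) → order F ≡ 2 * m + 1 → order F % 4 ≡ 3 →
    (α : Carrier F) → IsPrimitive F α →
    (a b : Carrier F) → InClass F α 2 1 a → InClass F α 2 1 b →
    FiniteField._*_ F a b ≡ 1# F →
    IsDSRG (vertexDec F 2) (blockVertices F 2) (blockC F α 2 (mat2 (1# F) a b (1# F)))
      (2 * (2 * m + 1)) (2 * m) m (m ∸ 1) m
corollary5p3 F m _ order≡ order%4≡3 α α-primitive a b a∈D₁ b∈D₁ ab≡1 =
  BlockMatrix.isDSRG F m order≡ m-odd α α-primitive a b a∈D₁ b∈D₁ ab≡1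
  where
    -- q ≡ 3 (mod 4) is what makes -1 a non-square.
    m-odd : parity m ≡ 1ℙ
    m-odd = mod4≡3⇒odd m (subst (λ q → q % 4 ≡ 3) order≡ order%4≡3)
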